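{- For all integers $n\ge 1$ and all $\alpha\in(0,1)$, $$\gamma(\alpha,n)\le \Big(\frac{n}{n+1}\Big)^{n+1}\cdot\frac{1}{\alpha n}.$$ Explicitly: for every integer $n\ge 1$, every $\alpha\in(0,1)$, every finite nonempty set $\Omega$ and every subset $A\subset\Omega^n$ with $\mu(A)=\alpha$, one has $$\mu(U(A))\le \Big(\frac{n}{n+1}\Big)^{n+1}\cdot\frac{1}{\alpha n}.$$
   Context: For a finite nonempty set $\Omega$ (the alphabet) and $n\ge 1$, $\mu=\mu_n$ denotes the uniform probability measure on $\Omega^n$, i.e. $\mu(A)=|A|/|\Omega|^n$. The shift map $s=s_m:\Omega^m\to\Omega^{m-1}$ is $s(w_1,\dots,w_m)=(w_2,\dots,w_m)$ (for each $m\ge 1$), and $s^j$ denotes its $j$-fold iterate, with $s^0$ the identity; so for $A\subset\Omega^n$ and $0\le j\le n-1$, $s^j(A)=\{(w_{j+1},\dots,w_n): (w_1,\dots,w_n)\in A\}\subset\Omega^{n-j}$. For $A\subset \Omega^n$ define $$U(A)=\Omega^n\setminus\bigcup_{j=0}^{n-1}\big(s^j(A)\times\Omega^j\big)\subset\Omega^n,$$ where $\Omega^{n-j}\times\Omega^j$ is identified with $\Omega^n$ by concatenation. Equivalently, $U(A)$ is the set of all $u=(u_1,\dots,u_n)\in\Omega^n$ such that for every $w=(w_1,\dots,w_n)\in A$ and every $j\in\{1,\dots,n\}$ one has $(w_{n-j+1},\dots,w_n)\ne(u_1,\dots,u_j)$ (no nonempty final segment of $w$ coincides with an initial segment of $u$).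 The quantity $\gamma(\alpha,n)$ is the largest possible value (supremum) of $\mu(U(A))$ over all finite nonempty sets $\Omega$ and all $A\subset\Omega^n$ with $\mu(A)=\alpha$. -}

module Defs where

open import Data.Fin.Base using (Fin; toℕ)
import Data.Fin.Properties as Fin
import Data.Integer.Base as ℤ
open import Data.List.Base using (List; [_]; length; map; filter; allFin; cartesianProductWith)
open import Data.List.Membership.Propositional using (_∈_; lose; find)
open import Data.List.Membership.Propositional.Properties using (∈-map⁺; ∈-allFin; ∈-cartesianProductWith⁺)
import Data.List.Relation.Unary.Any as Any
open Any using (here)
open import Data.Nat.Base as ℕ using (ℕ; zero; suc; _∸_)
import Data.Nat.Properties as ℕ
open import Data.Product.Base using (∃; _×_; _,_)
open import Data.Rational.Base as ℚ using (ℚ; 0ℚ)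
import Data.Rational.Properties as ℚ
open import Data.Vec.Base using (Vec; []; _∷_; _++_; cast; tail)
open import Data.Vec.Properties using (≡-dec)
open import Function.Bundles using (_↔_; module Inverse)
open import Function.Properties.Inverse using (↔⇒↣)
open import Level using (0ℓ)
open import Relation.Binary.Definitions using (DecidableEquality)
open import Relation.Binary.PropositionalEquality using (_≡_; refl; subst)
open import Relation.Nullary.Decidable using (Dec; map′; ¬?; _×-dec_)
open import Relation.Unary using (Pred; Decidable; ∁; ⋃)

open import Algebra.Definitions.RawSemiring ℚ.+-*-rawSemiring public using (_^_)

record FiniteNonempty (Ω : Set) : Set where
  field
    size        : ℕ
    .{{size≢0}} : ℕ.NonZero size
    enumeration : Ω ↔ Fin size

module _ {Ω : Set} where

  shift : ∀ {m} → Vec Ω (suc m) → Vec Ω m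
  shift = tail

  -- The clause for [] is only there for totality: it needs j > n.
  shift^ : ∀ {n} (j : ℕ) → Vec Ω n → Vec Ω (n ∸ j)
  shift^ zero    w         = w
  shift^ (suc j) []        = []
  shift^ (suc j) w@(_ ∷ _) = shift^ j (shift w)

  shiftImage : ∀ {n} (j : ℕ) → Pred (Vec Ω n) 0ℓ → Pred (Vec Ω (n ∸ j)) 0ℓ
  shiftImage j A v = ∃ λ w → A w × shift^ j w ≡ v

  -- B × Ωʲ, as a subset of Ωⁿ via concatenation Ωⁿ⁻ʲ × Ωʲ ≅ Ωⁿ.
  cylinder : ∀ {n} (j : Fin n) → Pred (Vec Ω (n ∸ toℕ j)) 0ℓ → Pred (Vec Ω n) 0ℓ
  cylinder {n} j B u = ∃ λ (v : Vec Ω (n ∸ toℕ j)) → ∃ λ (z : Vec Ω (toℕ j)) →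
    B v × cast (ℕ.m∸n+n≡m (ℕ.<⇒≤ (Fin.toℕ<n j))) (v ++ z) ≡ u

  U : ∀ {n} → Pred (Vec Ω n) 0ℓ → Pred (Vec Ω n) 0ℓ
  U {n} A = ∁ (⋃ (Fin n) λ j → cylinder j (shiftImage (toℕ j) A))

module _ {Ω : Set} {{fin : FiniteNonempty Ω}} where
  open FiniteNonempty fin

  letters : List Ω
  letters = map (Inverse.from enumeration) (allFin size)

  -- Lists every word exactly once, so that filtering it counts subsets of Ωⁿ.
  words : ∀ n → List (Vec Ω n)
  words zero    = [ [] ]
  words (suc n) = cartesianProductWith _∷_ letters (words n)

  card : ∀ {n} {A : Pred (Vec Ω n) 0ℓ} → Decidable A → ℕ
  card {n} A? = length (filter A? (words n))

  μ : ∀ {n} {A : Pred (Vec Ω n) 0ℓ} → Decidable A → ℚ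
  μ {n} A? = ℚ._/_ (ℤ.+ card A?) (size ℕ.^ n) {{ℕ.m^n≢0 size n}}

  ∈-letters : ∀ x → x ∈ letters
  ∈-letters x = subst (_∈ letters) (Inverse.strictlyInverseʳ enumeration x)
    (∈-map⁺ (Inverse.from enumeration) (∈-allFin (Inverse.to enumeration x)))

  ∈-words : ∀ {n} (w : Vec Ω n) → w ∈ words n
  ∈-words []      = here refl
  ∈-words (x ∷ w) = ∈-cartesianProductWith⁺ _∷_ (∈-letters x) (∈-words w)

  infix 4 _≟ʷ_
  _≟ʷ_ : ∀ {n} → DecidableEquality (Vec Ω n)
  _≟ʷ_ = ≡-dec (Fin.inj⇒≟ (↔⇒↣ enumeration))

  anyWord? : ∀ {n} {P : Pred (Vec Ω n) 0ℓ} → Decidable P → Dec (∃ P)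
  anyWord? {n} P? = map′
    (λ any → let w , _ , p = find any in w , p)
    (λ (w , p) → lose (∈-words w) p)
    (Any.any? P? (words n))

  shiftImage? : ∀ {n} j {A : Pred (Vec Ω n) 0ℓ} → Decidable A → Decidable (shiftImage j A)
  shiftImage? j A? v = anyWord? λ w → A? w ×-dec shift^ j w ≟ʷ v

  cylinder? : ∀ {n} (j : Fin n) {B : Pred (Vec Ω (n ∸ toℕ j)) 0ℓ} →
              Decidable B → Decidable (cylinder j B)
  cylinder? j B? u = anyWord? λ v → anyWord? λ z → B? v ×-dec cast _ (v ++ z) ≟ʷ u

  U? : ∀ {n} {A : Pred (Vec Ω n) 0ℓ} → Decidable A → Decidable (U A)
  U? A? u = ¬? (Fin.any? λ j → cylinder? j (shiftImage? (toℕ j) A?) u)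

α*n≢0 : ∀ {α} → 0ℚ ℚ.< α → ∀ n .{{_ : ℕ.NonZero n}} → ℚ.NonZero (α ℚ.* (ℤ.+ n ℚ./ 1))
α*n≢0 {α} 0<α n = ℚ.pos⇒nonZero (α ℚ.* (ℤ.+ n ℚ./ 1))
  {{ℚ.pos*pos⇒pos α {{ℚ.positive 0<α}} (ℤ.+ n ℚ./ 1) {{ℚ.normalize-pos n 1}}}}

{-# OPTIONS --safe #-}
module Submission where

-- Let G be the set of words with a nonempty prefix that is a suffix of some word of A. Words of U(A)
-- are not in G, while all nonempty suffixes of a word of A are in G; call words with this property
-- hereditary. So it suffices to bound P = h b, where h counts the hereditary words of length n and b
-- the words of length n not in G.
--
-- In a random word, say that an event happens at k if a hereditary block of length n ends just before k
-- and the word starting at k is not in G. Let d M be the probability that no event happens at the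
-- first M places. An event at k excludes events at the n preceding places, because the suffixes of the
-- hereditary block are in G. Moreover, that no event happened earlier is positively correlated
-- with a hereditary block coming next. With p = P / q²ⁿ this gives d (n+M+1) ≤ d (n+M) − p d M, and such a
-- recurrence has a positive solution only if p ≤ max ρⁿ(1−ρ) = nⁿ/(n+1)ⁿ⁺¹.

open import Data.Empty using (⊥)
open import Data.List.Base using (List; []; _∷_; [_]; _++_; map; length; take; drop; filter; cartesianProductWith; allFin)
open import Data.List.Properties using (map-∘; map-++; map-cong; length-++; length-map; length-tabulate; ++-assoc; length-drop; take++drop≡id; length-++-≤ˡ)
open import Data.Nat.Base as ℕ using (ℕ; zero; suc; NonZero; _∸_; z≤n; s≤s)
import Data.Nat.Properties as ℕ
open import Data.Nat.Tactic.RingSolver using (solve-∀)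
open import Data.Product.Base using (∃; _×_; _,_; map₂)
open import Data.Sum.Base as Sum using (_⊎_; inj₁; inj₂)
open import Data.Vec.Base as Vec using (Vec; []; _∷_; toList; fromList; cast)
open import Data.Vec.Properties using (length-toList; toList-++; toList-cast; toList∘fromList; toList-injective)
open import Function.Base using (_∘_; id)
open import Level using (0ℓ)
open import Relation.Binary.PropositionalEquality using (_≡_; refl; sym; trans; cong; cong₂; subst; subst₂; module ≡-Reasoning)
open import Relation.Nullary.Decidable using (Dec; yes; no; does; _×-dec_; _⊎-dec_; _→-dec_; ¬?)
open import Relation.Nullary.Negation using (¬_; contradiction)
open import Relation.Unary using (Pred; Decidable)

-- Elementary inequalities, and recurrences with a positive solution

module _ where
  open import Data.Nat.Base using (_+_; _*_; _^_; _≤_; _<_)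
  open import Data.Nat.Properties
  open ≤-Reasoning

  2mn≤m²+n² : ∀ m n → 2 * (m * n) ≤ m * m + n * n
  2mn≤m²+n² m n with ≤-total m n
  ... | inj₁ m≤n with k , refl ← m≤n⇒∃[o]m+o≡n m≤n = begin
    2 * (m * (m + k))                ≤⟨ m≤m+n _ (k * k) ⟩
    2 * (m * (m + k)) + k * k        ≡⟨ lemma m k ⟩
    m * m + (m + k) * (m + k)        ∎
    where
    lemma : ∀ m k → 2 * (m * (m + k)) + k * k ≡ m * m + (m + k) * (m + k)
    lemma = solve-∀
  ... | inj₂ n≤m with k , refl ← m≤n⇒∃[o]m+o≡n n≤m = begin
    2 * ((n + k) * n)                ≤⟨ m≤m+n _ (k * k) ⟩
    2 * ((n + k) * n) + k * k        ≡⟨ lemma n k ⟩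
    (n + k) * (n + k) + n * n        ∎
    where
    lemma : ∀ n k → 2 * ((n + k) * n) + k * k ≡ (n + k) * (n + k) + n * n
    lemma = solve-∀

  -- The tangent line of s ↦ sⁿ⁺¹ at t lies below the graph.
  bernoulli : ∀ n s t → suc n * (t ^ n * s) ≤ s ^ suc n + n * t ^ suc n
  bernoulli zero s t = ≤-reflexive (lemma s t)
    where
    lemma : ∀ s t → 1 * (1 * s) ≡ s * 1 + 0
    lemma = solve-∀
  -- The added term completes the left side to a multiple of 2st, so that 2st ≤ s² + t² applies; it
  -- reappears on the right when the induction hypothesis is multiplied by s.
  bernoulli (suc n) s t = +-cancelʳ-≤ (n * (t * T * s)) _ _ (begin
    suc (suc n) * (t * T * s) + n * (t * T * s)            ≡⟨ lemma₁ n s t T ⟩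
    suc n * T * (2 * (s * t))                              ≤⟨ *-monoʳ-≤ (suc n * T) (2mn≤m²+n² s t) ⟩
    suc n * T * (s * s + t * t)                            ≡⟨ lemma₂ n s t T ⟩
    s * (suc n * (T * s)) + suc n * (t * (t * T))          ≤⟨ +-monoˡ-≤ _ (*-monoʳ-≤ s (bernoulli n s t)) ⟩
    s * (s ^ suc n + n * (t * T)) + suc n * (t * (t * T))  ≡⟨ lemma₃ n s t T (s ^ suc n) ⟩
    s * s ^ suc n + suc n * (t * (t * T)) + n * (t * T * s) ∎)
    where
    T = t ^ n
    lemma₁ : ∀ n s t T → suc (suc n) * (t * T * s) + n * (t * T * s) ≡ suc n * T * (2 * (s * t))
    lemma₁ = solve-∀
    lemma₂ : ∀ n s t T → suc n * T * (s * s + t * t) ≡ s * (suc n * (T * s)) + suc n * (t * (t * T))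
    lemma₂ = solve-∀
    lemma₃ : ∀ n s t T S → s * (S + n * (t * T)) + suc n * (t * (t * T))
                         ≡ s * S + suc n * (t * (t * T)) + n * (t * T * s)
    lemma₃ = solve-∀

  ^-distribʳ-* : ∀ m n k → (m * n) ^ k ≡ m ^ k * n ^ k
  ^-distribʳ-* m n zero    = refl
  ^-distribʳ-* m n (suc k) = trans (cong (m * n *_) (^-distribʳ-* m n k)) (lemma m n (m ^ k) (n ^ k))
    where
    lemma : ∀ a b c d → a * b * (c * d) ≡ a * c * (b * d)
    lemma = solve-∀

  -- `bernoulli` at s = n(x + y) and t = (n + 1)y. These agree exactly when y = nx, where x yⁿ is
  -- largest for a given sum x + y.
  weighted-AM-GM : ∀ n .{{_ : NonZero n}} x y → suc n ^ suc n * (x * y ^ n) ≤ n ^ n * (x + y) ^ suc n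
  weighted-AM-GM n x y = *-cancelˡ-≤ n (+-cancelʳ-≤ (n * t ^ suc n) _ _ (begin
    n * (suc n ^ suc n * (x * y ^ n)) + n * t ^ suc n
      ≡⟨ cong (λ z → n * (suc n ^ suc n * (x * y ^ n)) + n * z) (^-distribʳ-* (suc n) y (suc n)) ⟩
    n * (suc n ^ suc n * (x * y ^ n)) + n * (suc n ^ suc n * y ^ suc n)
      ≡⟨ lemma₁ n x y (suc n ^ n) (y ^ n) ⟩
    suc n * (suc n ^ n * y ^ n * (n * (x + y)))
      ≡⟨ cong (λ z → suc n * (z * (n * (x + y)))) (^-distribʳ-* (suc n) y n) ⟨
    suc n * (t ^ n * (n * (x + y)))
      ≤⟨ bernoulli n (n * (x + y)) t ⟩
    (n * (x + y)) ^ suc n + n * t ^ suc n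
      ≡⟨ cong (_+ n * t ^ suc n) (trans (^-distribʳ-* n (x + y) (suc n)) (*-assoc n (n ^ n) _)) ⟩
    n * (n ^ n * (x + y) ^ suc n) + n * t ^ suc n ∎))
    where
    t = suc n * y
    lemma₁ : ∀ n x y c d → n * (suc n * c * (x * d)) + n * (suc n * c * (y * d))
                         ≡ suc n * (c * d * (n * (x + y)))
    lemma₁ = solve-∀

  -- With d M = e M / q ^ M and p = P / q ^ 2n the hypothesis reads d (n+M+1) ≤ d (n+M) − p d M.
  -- If p exceeds nⁿ/(n+1)ⁿ⁺¹, the maximum of ρⁿ(1−ρ), by at least 1/K, then a bound
  -- d (M+1) ≤ ρ d M for all large M improves to d (M+1) ≤ (ρ − 1/K) d M for all larger M;
  -- after K rounds this contradicts d > 0.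
  module _ (n q P : ℕ) .{{_ : NonZero n}} .{{_ : NonZero q}} (e : ℕ → ℕ)
    (e>0 : ∀ M → 0 < e M)
    (rec : ∀ M → q ^ n * e (suc (n + M)) + q * P * e M ≤ q * q ^ n * e (n + M))
    where

    private
      L = suc n ^ suc n
      -- A common denominator of p and nⁿ/(n+1)ⁿ⁺¹: if p is larger, then by at least 1/K.
      K = q ^ n * q ^ n * L

      instance
        qⁿ≢0 : NonZero (q ^ n)
        qⁿ≢0 = m^n≢0 q n
        L≢0 : NonZero L
        L≢0 = m^n≢0 (suc n) (suc n)
        K≢0 : NonZero K
        K≢0 = m*n≢0 (q ^ n * q ^ n) L {{m*n≢0 (q ^ n) (q ^ n)}}
        KⁿL≢0 : NonZero (K ^ n * L)
        KⁿL≢0 = m*n≢0 (K ^ n) L {{m^n≢0 K n}}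

      -- In terms of d, this is the bound d (M+1) ≤ ρ d M with ρ = j / K.
      DecaysFrom : ℕ → ℕ → Set
      DecaysFrom o j = ∀ M → o ≤ M → K * e (suc M) ≤ j * q * e M

      decay-iterate : ∀ {o} j → DecaysFrom o j → ∀ M → o ≤ M → ∀ i → K ^ i * e (i + M) ≤ (j * q) ^ i * e M
      decay-iterate j D M o≤M zero    = ≤-refl
      decay-iterate j D M o≤M (suc i) = begin
        K * K ^ i * e (suc (i + M))       ≡⟨ lemma K (K ^ i) _ ⟩
        K ^ i * (K * e (suc (i + M)))     ≤⟨ *-monoʳ-≤ (K ^ i) (D (i + M) (≤-trans o≤M (m≤n+m M i))) ⟩
        K ^ i * (j * q * e (i + M))       ≡⟨ lemma (j * q) (K ^ i) _ ⟨
        (j * q) * K ^ i * e (i + M)       ≡⟨ *-assoc (j * q) _ _ ⟩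
        (j * q) * (K ^ i * e (i + M))     ≤⟨ *-monoʳ-≤ (j * q) (decay-iterate j D M o≤M i) ⟩
        (j * q) * ((j * q) ^ i * e M)     ≡⟨ *-assoc (j * q) _ _ ⟨
        (j * q) ^ suc i * e M             ∎
        where
        lemma : ∀ a b c → a * b * c ≡ b * (a * c)
        lemma = solve-∀

      module _ (large : n ^ n * (q ^ n * q ^ n) < P * L) where

        -- With ρ = (j+1) / K this reads (1 - ρ + 1/K) ρⁿ ≤ p. AM-GM bounds (1 - ρ) ρⁿ by
        -- nⁿ/(n+1)ⁿ⁺¹, and the excess of p over that is at least 1/K, hence at least ρⁿ/K.
        gap : ∀ x j → x + suc j ≡ K → q ^ n * q ^ n * (L * (suc x * suc j ^ n)) ≤ P * L * (K * K ^ n)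
        gap x j x+J≡K = begin
          Q * (L * (suc x * J ^ n))              ≡⟨ lemma₁ Q L x (J ^ n) ⟩
          Q * (L * (x * J ^ n)) + K * J ^ n      ≤⟨ +-mono-≤ (*-monoʳ-≤ Q (weighted-AM-GM n x J))
                                                             (*-monoʳ-≤ K (^-monoˡ-≤ n J≤K)) ⟩
          Q * (n ^ n * (x + J) ^ suc n) + K * K ^ n ≡⟨ cong (λ k → Q * (n ^ n * k ^ suc n) + K * K ^ n) x+J≡K ⟩
          Q * (n ^ n * K ^ suc n) + K * K ^ n    ≡⟨ lemma₂ Q (n ^ n) (K * K ^ n) ⟩
          suc (n ^ n * Q) * (K * K ^ n)          ≤⟨ *-monoˡ-≤ (K * K ^ n) large ⟩
          P * L * (K * K ^ n)                    ∎
          where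
          J = suc j
          Q = q ^ n * q ^ n
          J≤K : J ≤ K
          J≤K = ≤-trans (m≤n+m J x) (≤-reflexive x+J≡K)
          lemma₁ : ∀ Q L x y → Q * (L * (suc x * y)) ≡ Q * (L * (x * y)) + Q * L * y
          lemma₁ = solve-∀
          lemma₂ : ∀ Q N k → Q * (N * k) + k ≡ suc (N * Q) * k
          lemma₂ = solve-∀

        -- Iterating the old bound n times gives d (n+M) ≤ ρⁿ d M for M ≥ o. By `gap` the loss p d M
        -- is then at least (1 - ρ + 1/K) d (n+M), and the recurrence leaves at most (ρ - 1/K) d
        -- (n+M).
        decay-improve : ∀ {o} x j → x + suc j ≡ K → DecaysFrom o (suc j) → DecaysFrom (n + o) j
        decay-improve {o} x j x+J≡K D N n+o≤N with k , refl ← m≤n⇒∃[o]m+o≡n n+o≤N =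
          subst (λ N → K * e (suc N) ≤ j * q * e N) (sym (+-assoc n o k)) (*-cancelʳ-≤ _ _ (q ^ n)
            (+-cancelʳ-≤ (K * (q * P * e M)) _ _ (begin
              K * e₁ * q ^ n + K * (q * P * e M)             ≡⟨ lemma₁ K e₁ (q ^ n) (q * P * e M) ⟩
              K * (q ^ n * e₁ + q * P * e M)                 ≤⟨ *-monoʳ-≤ K (rec M) ⟩
              K * (q * q ^ n * eₙ)                           ≡⟨ cong (_* (q * q ^ n * eₙ)) x+J≡K ⟨
              (x + suc j) * (q * q ^ n * eₙ)                 ≡⟨ lemma₂ x j q (q ^ n) eₙ ⟩
              j * q * eₙ * q ^ n + suc x * (q * q ^ n * eₙ)  ≤⟨ +-monoʳ-≤ _ loss ⟩
              j * q * eₙ * q ^ n + K * (q * P * e M)         ∎)))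
          where
          M = o + k
          e₁ = e (suc (n + M))
          eₙ = e (n + M)
          lemma₁ : ∀ K a b c → K * a * b + K * c ≡ K * (b * a + c)
          lemma₁ = solve-∀
          lemma₂ : ∀ x j q r a → (x + suc j) * (q * r * a) ≡ j * q * a * r + suc x * (q * r * a)
          lemma₂ = solve-∀
          lemma₃ : ∀ a q r E k L → k * L * (a * (q * r * E)) ≡ L * (a * (q * r)) * (k * E)
          lemma₃ = solve-∀
          lemma₄ : ∀ a q r E J L → L * (a * (q * r)) * (J * r * E) ≡ q * E * (r * r * (L * (a * J)))
          lemma₄ = solve-∀
          lemma₅ : ∀ q E P L K k → q * E * (P * L * (K * k)) ≡ k * L * (K * (q * P * E))
          lemma₅ = solve-∀
          loss : suc x * (q * q ^ n * eₙ) ≤ K * (q * P * e M)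
          loss = *-cancelˡ-≤ (K ^ n * L) (begin
            K ^ n * L * (suc x * (q * q ^ n * eₙ))
              ≡⟨ lemma₃ (suc x) q (q ^ n) eₙ (K ^ n) L ⟩
            L * (suc x * (q * q ^ n)) * (K ^ n * eₙ)
              ≤⟨ *-monoʳ-≤ (L * (suc x * (q * q ^ n))) (decay-iterate (suc j) D M (m≤m+n o k) n) ⟩
            L * (suc x * (q * q ^ n)) * ((suc j * q) ^ n * e M)
              ≡⟨ cong (λ z → L * (suc x * (q * q ^ n)) * (z * e M)) (^-distribʳ-* (suc j) q n) ⟩
            L * (suc x * (q * q ^ n)) * (suc j ^ n * q ^ n * e M)
              ≡⟨ lemma₄ (suc x) q (q ^ n) (e M) (suc j ^ n) L ⟩
            q * e M * (q ^ n * q ^ n * (L * (suc x * suc j ^ n)))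
              ≤⟨ *-monoʳ-≤ (q * e M) (gap x j x+J≡K) ⟩
            q * e M * (P * L * (K * K ^ n))
              ≡⟨ lemma₅ q (e M) P L K (K ^ n) ⟩
            K ^ n * L * (K * (q * P * e M)) ∎)

        -- Dropping the loss p d M from the recurrence gives ρ = 1.
        decay-start : DecaysFrom n K
        decay-start N n≤N with k , refl ← m≤n⇒∃[o]m+o≡n n≤N =
          ≤-trans (*-monoʳ-≤ K (*-cancelˡ-≤ (q ^ n) (begin
            q ^ n * e (suc (n + k))                   ≤⟨ m≤m+n _ _ ⟩
            q ^ n * e (suc (n + k)) + q * P * e k     ≤⟨ rec k ⟩
            q * q ^ n * e (n + k)                     ≡⟨ lemma q (q ^ n) (e (n + k)) ⟩
            q ^ n * (q * e (n + k))                   ∎)))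
            (≤-reflexive (sym (*-assoc K q _)))
          where
          lemma : ∀ a b c → a * b * c ≡ b * (a * c)
          lemma = solve-∀

        no-decay-to-zero : ∀ {o} x j → x + j ≡ K → DecaysFrom o j → ⊥
        -- At ρ = 0 the bound would make `e (suc o)` vanish.
        no-decay-to-zero {o} x zero _ D =
          contradiction (D o ≤-refl) (<⇒≱ (*-mono-< {0} {K} {0} (ℕ.>-nonZero⁻¹ K) (e>0 (suc o))))
        no-decay-to-zero x (suc j) x+J≡K D =
          no-decay-to-zero (suc x) j (trans (sym (+-suc x j)) x+J≡K) (decay-improve x j x+J≡K D)

    positive-recurrence-bound : P * suc n ^ suc n ≤ n ^ n * (q ^ n * q ^ n)
    positive-recurrence-bound = ≮⇒≥ λ large → no-decay-to-zero large 0 K refl (decay-start large)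

-- Counting by sums of indicators

module _ where
  open import Defs hiding (_^_)
  open import Data.Bool.Base using (if_then_else_)
  open import Data.List.Membership.Propositional using (_∈_)
  open import Data.List.Relation.Unary.Any using (here; there)
  open import Data.Nat.Base using (_+_; _*_; _^_; _≤_; _<_)
  open import Data.Nat.ListAction using (sum)
  open import Data.Nat.ListAction.Properties using (sum-++)
  open import Data.Nat.Properties
  open import Data.Unit.Base using (⊤; tt)
  open ≤-Reasoning

  -- Opaque, so that unification recovers the decision procedures and summands.
  opaque

    ⟦_⟧ : {P : Set} → Dec P → ℕ
    ⟦ P? ⟧ = if does P? then 1 else 0

    ⟦⟧≤1 : {P : Set} (P? : Dec P) → ⟦ P? ⟧ ≤ 1
    ⟦⟧≤1 (yes _) = ≤-refl
    ⟦⟧≤1 (no _)  = z≤n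

    ⟦⟧-holds : {P : Set} {P? : Dec P} → P → 1 ≤ ⟦ P? ⟧
    ⟦⟧-holds {P? = yes _} _ = ≤-refl
    ⟦⟧-holds {P? = no ¬p} p = contradiction p ¬p

    ⟦⟧-fails : {P : Set} {P? : Dec P} → ¬ P → ⟦ P? ⟧ ≤ 0
    ⟦⟧-fails {P? = yes p} ¬p = contradiction p ¬p
    ⟦⟧-fails {P? = no _}  _  = ≤-refl

    ⟦⟧-mono : {P Q : Set} {P? : Dec P} {Q? : Dec Q} → (P → Q) → ⟦ P? ⟧ ≤ ⟦ Q? ⟧
    ⟦⟧-mono {P? = yes p} {Q?} P→Q = ⟦⟧-holds {P? = Q?} (P→Q p)
    ⟦⟧-mono {P? = no _}  P→Q = z≤n

    -- P and Q × R are disjoint parts of S. The product of indicators lets ⟦ R? ⟧ be taken out of a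
    -- sum in which only Q varies.
    ⟦⟧-disjoint : {P Q R S : Set} {P? : Dec P} {Q? : Dec Q} {R? : Dec R} {S? : Dec S} →
      (P → S) → (Q → R → S) → (P → Q → ¬ R) → ⟦ P? ⟧ + ⟦ Q? ⟧ * ⟦ R? ⟧ ≤ ⟦ S? ⟧
    ⟦⟧-disjoint {P? = no _}  {no _}          _   _    _ = z≤n
    ⟦⟧-disjoint {P? = no _}  {yes _} {no _}  _   _    _ = z≤n
    ⟦⟧-disjoint {P? = no _}  {yes q} {yes r} {S?} _ QR→S _ = ⟦⟧-holds {P? = S?} (QR→S q r)
    ⟦⟧-disjoint {P? = yes p} {no _} {_} {S?} P→S _ _ = ⟦⟧-holds {P? = S?} (P→S p)
    ⟦⟧-disjoint {P? = yes p} {yes _} {no _} {S?} P→S _ _ = ⟦⟧-holds {P? = S?} (P→S p)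
    ⟦⟧-disjoint {P? = yes p} {yes q} {yes r} _   _    d = contradiction r (d p q)

  ∑ : {A : Set} → List A → (A → ℕ) → ℕ
  ∑ xs f = sum (map f xs)

  module _ {A : Set} where

    ∑-mono : ∀ xs {f g : A → ℕ} → (∀ x → f x ≤ g x) → ∑ xs f ≤ ∑ xs g
    ∑-mono []       f≤g = z≤n
    ∑-mono (x ∷ xs) f≤g = +-mono-≤ (f≤g x) (∑-mono xs f≤g)

    ∑-cong : ∀ xs {f g : A → ℕ} → (∀ x → f x ≡ g x) → ∑ xs f ≡ ∑ xs g
    ∑-cong xs f≡g = cong sum (map-cong f≡g xs)

    ∑-+ : ∀ xs (f g : A → ℕ) → ∑ xs (λ x → f x + g x) ≡ ∑ xs f + ∑ xs g
    ∑-+ []       f g = refl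
    ∑-+ (x ∷ xs) f g = trans (cong (f x + g x +_) (∑-+ xs f g)) (lemma (f x) (g x) _ _)
      where
      lemma : ∀ a b c d → a + b + (c + d) ≡ a + c + (b + d)
      lemma = solve-∀

    ∑-*ʳ : ∀ xs (f : A → ℕ) c → ∑ xs (λ x → f x * c) ≡ ∑ xs f * c
    ∑-*ʳ []       f c = refl
    ∑-*ʳ (x ∷ xs) f c = trans (cong (f x * c +_) (∑-*ʳ xs f c)) (sym (*-distribʳ-+ c (f x) _))

    ∑-const : ∀ (xs : List A) c → ∑ xs (λ _ → c) ≡ length xs * c
    ∑-const []       c = refl
    ∑-const (x ∷ xs) c = cong (c +_) (∑-const xs c)

    term≤∑ : ∀ {x xs} (f : A → ℕ) → x ∈ xs → f x ≤ ∑ xs f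
    term≤∑ f (here refl)  = m≤m+n _ _
    term≤∑ f (there x∈xs) = ≤-trans (term≤∑ f x∈xs) (m≤n+m _ _)

    opaque
      unfolding ⟦_⟧

      length-filter≡∑ : ∀ {P : Pred A 0ℓ} (P? : Decidable P) xs → length (filter P? xs) ≡ ∑ xs (⟦_⟧ ∘ P?)
      length-filter≡∑ P? []       = refl
      length-filter≡∑ P? (x ∷ xs) with P? x
      ... | yes _ = cong suc (length-filter≡∑ P? xs)
      ... | no _  = length-filter≡∑ P? xs

  ∑-cartesianProductWith : ∀ {A B C : Set} (_∙_ : A → B → C) xs ys f →
    ∑ (cartesianProductWith _∙_ xs ys) f ≡ ∑ xs (λ x → ∑ ys (λ y → f (x ∙ y)))
  ∑-cartesianProductWith _∙_ []       ys f = refl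
  ∑-cartesianProductWith _∙_ (x ∷ xs) ys f =
    trans (cong sum (map-++ f (map (x ∙_) ys) _))
   (trans (sum-++ (map f (map (x ∙_) ys)) _)
          (cong₂ _+_ (cong sum (sym (map-∘ ys))) (∑-cartesianProductWith _∙_ xs ys f)))

  -- Sums over words

  module _ {Ω : Set} {{fin : FiniteNonempty Ω}} where
    open FiniteNonempty fin using (size≢0) renaming (size to q)

    opaque

      -- Summands take lists, so that words can be concatenated and cut without casts between
      -- lengths.
      Σʷ : ℕ → (List Ω → ℕ) → ℕ
      Σʷ m f = ∑ (words m) (f ∘ toList)

      Σʷ-zero : ∀ f → Σʷ 0 f ≡ f []
      Σʷ-zero f = +-identityʳ (f [])

      Σʷ-suc : ∀ m f → Σʷ (suc m) f ≡ ∑ letters (λ x → Σʷ m (λ w → f (x ∷ w)))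
      Σʷ-suc m f = ∑-cartesianProductWith Vec._∷_ letters (words m) (f ∘ toList)

      Σʷ-mono : ∀ m {f g} → (∀ (w : Vec Ω m) → f (toList w) ≤ g (toList w)) → Σʷ m f ≤ Σʷ m g
      Σʷ-mono m f≤g = ∑-mono (words m) f≤g

      Σʷ-cong : ∀ m {f g} → (∀ w → f w ≡ g w) → Σʷ m f ≡ Σʷ m g
      Σʷ-cong m f≡g = ∑-cong (words m) (f≡g ∘ toList)

      Σʷ-+ : ∀ m f g → Σʷ m (λ w → f w + g w) ≡ Σʷ m f + Σʷ m g
      Σʷ-+ m f g = ∑-+ (words m) _ _

      Σʷ-*ʳ : ∀ m f c → Σʷ m (λ w → f w * c) ≡ Σʷ m f * c
      Σʷ-*ʳ m f c = ∑-*ʳ (words m) _ c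

      term≤Σʷ : ∀ {m} f (w : Vec Ω m) → f (toList w) ≤ Σʷ m f
      term≤Σʷ f w = term≤∑ (f ∘ toList) (∈-words w)

      card≤Σʷ : ∀ {m} {A : Pred (Vec Ω m) 0ℓ} (A? : Decidable A) {B : Pred (List Ω) 0ℓ} {B? : Decidable B} →
        (∀ w → A w → B (toList w)) → card A? ≤ Σʷ m (λ w → ⟦ B? w ⟧)
      card≤Σʷ {m} A? A⊂B = ≤-trans (≤-reflexive (length-filter≡∑ A? (words m)))
                                   (∑-mono (words m) (λ w → ⟦⟧-mono (A⊂B w)))

    length-letters : length letters ≡ q
    length-letters = trans (length-map _ (allFin q)) (length-tabulate {n = q} id)

    Σʷ-const : ∀ m c → Σʷ m (λ _ → c) ≡ q ^ m * c
    Σʷ-const zero    c = trans (Σʷ-zero _) (sym (+-identityʳ c))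
    Σʷ-const (suc m) c = begin-equality
      Σʷ (suc m) (λ _ → c)          ≡⟨ Σʷ-suc m _ ⟩
      ∑ letters (λ _ → Σʷ m (λ _ → c)) ≡⟨ ∑-cong letters (λ _ → Σʷ-const m c) ⟩
      ∑ letters (λ _ → q ^ m * c)   ≡⟨ ∑-const letters _ ⟩
      length letters * (q ^ m * c)  ≡⟨ cong (_* (q ^ m * c)) length-letters ⟩
      q * (q ^ m * c)               ≡⟨ *-assoc q _ c ⟨
      q ^ suc m * c                 ∎

    Σʷ-split : ∀ m k f → Σʷ (m + k) f ≡ Σʷ m (λ u → Σʷ k (λ v → f (u ++ v)))
    Σʷ-split zero    k f = sym (Σʷ-zero _)
    Σʷ-split (suc m) k f = begin-equality
      Σʷ (suc m + k) f                                                     ≡⟨ Σʷ-suc (m + k) f ⟩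
      ∑ letters (λ x → Σʷ (m + k) (λ w → f (x ∷ w)))                       ≡⟨ ∑-cong letters (λ x → Σʷ-split m k _) ⟩
      ∑ letters (λ x → Σʷ m (λ u → Σʷ k (λ v → f (x ∷ u ++ v))))           ≡⟨ Σʷ-suc m _ ⟨
      Σʷ (suc m) (λ u → Σʷ k (λ v → f (u ++ v)))                           ∎

    -- Both sides sum over words of length m + k, cut at different places. With k = 1 this trades a
    -- letter at the end for a letter at the front.
    Σʷ-rotate : ∀ m k f → Σʷ m (λ u → Σʷ k (λ v → f (u ++ v))) ≡ Σʷ k (λ u → Σʷ m (λ v → f (u ++ v)))
    Σʷ-rotate m k f = begin-equality
      Σʷ m (λ u → Σʷ k (λ v → f (u ++ v))) ≡⟨ Σʷ-split m k f ⟨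
      Σʷ (m + k) f                         ≡⟨ cong (λ l → Σʷ l f) (+-comm m k) ⟩
      Σʷ (k + m) f                         ≡⟨ Σʷ-split k m f ⟩
      Σʷ k (λ u → Σʷ m (λ v → f (u ++ v))) ∎

    -- For the theorem, G u says that some nonempty prefix of u is a suffix of a word of A.
    module Occurrences (n : ℕ) .{{_ : NonZero n}} {G : Pred (List Ω) 0ℓ} (G? : Decidable G)
      (G-++     : ∀ {u} v → G u → G (u ++ v))
      (G-late   : ∀ u {v} → G (u ++ v) → ¬ G u → G v)
      (G-prefix : ∀ {u} v → n ≤ length u → G (u ++ v) → G u)
      where

      -- Hereditary words and their correlation with monotone events

      Hereditary : Pred (List Ω) 0ℓ
      Hereditary []      = ⊤
      Hereditary (x ∷ w) = G (x ∷ w) × Hereditary w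

      hereditary? : Decidable Hereditary
      hereditary? []      = yes tt
      hereditary? (x ∷ w) = G? (x ∷ w) ×-dec hereditary? w

      hereditary-++ : ∀ {u v} → Hereditary u → Hereditary v → Hereditary (u ++ v)
      hereditary-++ {[]}    _        hv = hv
      hereditary-++ {x ∷ u} (g , hu) hv = G-++ _ g , hereditary-++ hu hv

      hereditary-suffix : ∀ u {v} → Hereditary (u ++ v) → Hereditary v
      hereditary-suffix []      h       = h
      hereditary-suffix (x ∷ u) (_ , h) = hereditary-suffix u h

      hereditary-drop : ∀ k {w} → Hereditary w → Hereditary (drop k w)
      hereditary-drop k {w} h = hereditary-suffix (take k w) (subst Hereditary (sym (take++drop≡id k w)) h)

      hereditary⇒G : ∀ {w} → 0 < length w → Hereditary w → G w
      hereditary⇒G {_ ∷ _} _ (g , _) = g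

      #hereditary #avoiding : ℕ → ℕ
      #hereditary m = Σʷ m (λ w → ⟦ hereditary? w ⟧)
      #avoiding   m = Σʷ m (λ w → ⟦ ¬? (G? w) ⟧)

      -- The last m letters of a hereditary word are hereditary, so the proportion of hereditary
      -- words cannot increase with the length.
      #hereditary-density : ∀ {m} → m ≤ n → q ^ m * #hereditary n ≤ #hereditary m * q ^ n
      #hereditary-density {m} m≤n with k , refl ← m≤n⇒∃[o]m+o≡n m≤n = begin
        q ^ m * #hereditary (m + k)
          ≡⟨ cong (λ l → q ^ m * #hereditary l) (+-comm m k) ⟩
        q ^ m * #hereditary (k + m)
          ≡⟨ cong (q ^ m *_) (Σʷ-split k m _) ⟩
        q ^ m * Σʷ k (λ u → Σʷ m (λ v → ⟦ hereditary? (u ++ v) ⟧))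
          ≤⟨ *-monoʳ-≤ (q ^ m) (Σʷ-mono k (λ u → Σʷ-mono m (λ v →
               ⟦⟧-mono (hereditary-suffix (toList u))))) ⟩
        q ^ m * Σʷ k (λ u → #hereditary m)
          ≡⟨ cong (q ^ m *_) (Σʷ-const k _) ⟩
        q ^ m * (q ^ k * #hereditary m)
          ≡⟨ lemma (q ^ m) (q ^ k) (#hereditary m) ⟩
        #hereditary m * (q ^ m * q ^ k)
          ≡⟨ cong (#hereditary m *_) (^-distribˡ-+-* q m k) ⟨
        #hereditary m * q ^ (m + k) ∎
        where
        lemma : ∀ a b c → a * (b * c) ≡ c * (a * b)
        lemma = solve-∀

      -- Once X holds for the letters read so far, it holds for every continuation and the remaining
      -- letters are unconstrained; until then X forces every suffix of the word to start in G.
      hereditary-correlation : ∀ m → m ≤ n → {X : Pred (List Ω) 0ℓ} (X? : Decidable X) →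
        (∀ u {v} → X u → X (u ++ v)) → (∀ u {v} → X (u ++ v) → ¬ X u → G v) →
        Σʷ m (λ w → ⟦ X? w ⟧) * #hereditary n ≤ Σʷ m (λ w → ⟦ X? w ×-dec hereditary? w ⟧) * q ^ n
      hereditary-correlation m m≤n X? X-++ X-late with X? []
      -- X holds for every word, so only the densities at lengths m and n are compared.
      ... | yes x = begin
        Σʷ m (λ w → ⟦ X? w ⟧) * #hereditary n
          ≤⟨ *-monoˡ-≤ (#hereditary n) (Σʷ-mono m (λ w → ⟦⟧≤1 (X? (toList w)))) ⟩
        Σʷ m (λ w → 1) * #hereditary n
          ≡⟨ cong (_* #hereditary n) (trans (Σʷ-const m 1) (*-identityʳ (q ^ m))) ⟩
        q ^ m * #hereditary n
          ≤⟨ #hereditary-density m≤n ⟩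
        #hereditary m * q ^ n
          ≤⟨ *-monoˡ-≤ (q ^ n) (Σʷ-mono m (λ w →
               ⟦⟧-mono (X-++ [] x ,_))) ⟩
        Σʷ m (λ w → ⟦ X? w ×-dec hereditary? w ⟧) * q ^ n ∎
      hereditary-correlation zero m≤n X? X-++ X-late | no ¬x =
        ≤-trans (*-monoˡ-≤ (#hereditary n) (≤-trans (≤-reflexive (Σʷ-zero _)) (⟦⟧-fails ¬x))) z≤n
      hereditary-correlation (suc m) m<n X? X-++ X-late | no ¬x = begin
        Σʷ (suc m) (λ w → ⟦ X? w ⟧) * h
          ≡⟨ cong (_* h) (Σʷ-suc m _) ⟩
        ∑ letters (λ x → Σʷ m (λ w → ⟦ X? (x ∷ w) ⟧)) * h
          ≡⟨ ∑-*ʳ letters _ h ⟨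
        ∑ letters (λ x → Σʷ m (λ w → ⟦ X? (x ∷ w) ⟧) * h)
          -- Once the first letter x is fixed, X becomes a condition on the remaining m letters; the
          -- reference length n stays the same.
          ≤⟨ ∑-mono letters (λ x → hereditary-correlation m (<⇒≤ m<n) (X? ∘ (x ∷_)) (X-++ ∘ (x ∷_)) (X-late ∘ (x ∷_))) ⟩
        ∑ letters (λ x → Σʷ m (λ w → ⟦ X? (x ∷ w) ×-dec hereditary? w ⟧) * q ^ n)
          ≡⟨ ∑-*ʳ letters _ (q ^ n) ⟩
        ∑ letters (λ x → Σʷ m (λ w → ⟦ X? (x ∷ w) ×-dec hereditary? w ⟧)) * q ^ n
          -- X fails for the empty word and holds for x ∷ w, so `X-late` puts x ∷ w itself into G:
          -- this is what w lacks to make x ∷ w hereditary.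
          ≤⟨ *-monoˡ-≤ (q ^ n) (∑-mono letters (λ x → Σʷ-mono m (λ w →
               ⟦⟧-mono (λ (xw , hw) → xw , X-late [] xw ¬x , hw)))) ⟩
        ∑ letters (λ x → Σʷ m (λ w → ⟦ X? (x ∷ w) ×-dec hereditary? (x ∷ w) ⟧)) * q ^ n
          ≡⟨ cong (_* q ^ n) (Σʷ-suc m _) ⟨
        Σʷ (suc m) (λ w → ⟦ X? w ×-dec hereditary? w ⟧) * q ^ n ∎
        where
        h = #hereditary n

      -- Free p y: at each hereditary block of length n ending strictly inside p, the rest of p ++ y
      -- satisfies G. A block ending exactly at the end of p is tested only once p has grown.
      Answered : List Ω → List Ω → Set
      Answered w y = Hereditary (take n w) → n < length w → G (drop n w ++ y)

      answered? : ∀ w y → Dec (Answered w y)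
      answered? w y = hereditary? (take n w) →-dec (n <? length w →-dec G? (drop n w ++ y))

      Free : List Ω → List Ω → Set
      Free []      y = ⊤
      Free (x ∷ p) y = Answered (x ∷ p) y × Free p y

      free? : ∀ p y → Dec (Free p y)
      free? []      y = yes tt
      free? (x ∷ p) y = answered? (x ∷ p) y ×-dec free? p y

      -- How freeness behaves when words are extended or cut

      take-++ : ∀ k (u : List Ω) {v} → k ≤ length u → take k (u ++ v) ≡ take k u
      take-++ zero    u       _         = refl
      take-++ (suc k) (x ∷ u) (s≤s k≤u) = cong (x ∷_) (take-++ k u k≤u)

      drop-++ : ∀ k (u : List Ω) {v} → k ≤ length u → drop k (u ++ v) ≡ drop k u ++ v
      drop-++ zero    u       _         = refl
      drop-++ (suc k) (x ∷ u) (s≤s k≤u) = drop-++ k u k≤u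

      drop-++ʳ : ∀ k (u : List Ω) {v} → length u ≤ k → drop k (u ++ v) ≡ drop (k ∸ length u) v
      drop-++ʳ k       []      _         = refl
      drop-++ʳ (suc k) (x ∷ u) (s≤s u≤k) = drop-++ʳ k u u≤k

      free-++ : ∀ p u {v} → Free p u → Free p (u ++ v)
      free-++ []      u f       = tt
      free-++ (x ∷ p) u (a , f) =
        (λ h n<w → subst G (++-assoc (drop n (x ∷ p)) u _) (G-++ _ (a h n<w))) , free-++ p u f

      -- With `free-++`, this makes `Free p` a valid X for `hereditary-correlation`. A constraint
      -- met by u ++ v but not by u needs the letters of v, and `G-late` applies to it.
      free-late : ∀ p u {v} → Free p (u ++ v) → ¬ Free p u → G v
      free-late []      u _       ¬f = contradiction tt ¬f
      free-late (x ∷ p) u (a , f) ¬f with free? p u | hereditary? (take n (x ∷ p)) | n <? length (x ∷ p)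
      ... | no ¬f′ | _     | _       = free-late p u f ¬f′
      ... | yes f′ | no ¬h | _       = contradiction ((λ h → contradiction h ¬h) , f′) ¬f
      ... | yes f′ | yes _ | no n≮w  = contradiction ((λ _ n<w → contradiction n<w n≮w) , f′) ¬f
      ... | yes f′ | yes h | yes n<w =
        G-late (drop n (x ∷ p) ++ u) (subst G (sym (++-assoc (drop n (x ∷ p)) u _)) (a h n<w))
          (λ g → ¬f ((λ _ _ → g) , f′))

      free-prefix : ∀ p u {v} → n ≤ length u → Free p (u ++ v) → Free p u
      free-prefix []      u n≤u _       = tt
      free-prefix (x ∷ p) u n≤u (a , f) =
        (λ h n<w → G-prefix _ (≤-trans n≤u (≤-trans (m≤n+m _ _) (≤-reflexive (sym (length-++ (drop n (x ∷ p)))))))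
          (subst G (sym (++-assoc (drop n (x ∷ p)) u _)) (a h n<w)))
        , free-prefix p u n≤u f

      -- A block ending strictly inside p also ends strictly inside p ++ u, with the same remainder;
      -- only constraints at later places are lost.
      free-shift : ∀ p u {v} → Free (p ++ u) v → Free p (u ++ v)
      free-shift []      u     f       = tt
      free-shift (x ∷ p) u {v} (a , f) =
        (λ h n<w → subst G (trans (cong (_++ v) (drop-++ n (x ∷ p) (<⇒≤ n<w))) (++-assoc (drop n (x ∷ p)) u v))
          (a (subst Hereditary (sym (take-++ n (x ∷ p) (<⇒≤ n<w))) h)
             (<-≤-trans n<w (length-++-≤ˡ (x ∷ p)))))
        , free-shift p u f

      take-length-++ : ∀ (u : List Ω) {v} → take (length u) (u ++ v) ≡ u
      take-length-++ []      = refl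
      take-length-++ (x ∷ u) = cong (x ∷_) (take-length-++ u)

      drop-length-++ : ∀ (u : List Ω) {v} → drop (length u) (u ++ v) ≡ v
      drop-length-++ []      = refl
      drop-length-++ (x ∷ u) = drop-length-++ u

      -- Since x is nonempty, the block a ends strictly inside the tested word, and its constraint
      -- is in force.
      free-answered : ∀ p {a x y} → length a ≡ n → Hereditary a → 0 < length x → Free ((p ++ a) ++ x) y → G (x ++ y)
      free-answered []      {[]}    {x ∷ xs} {y} refl _ _   (ans , _) = ans tt (s≤s z≤n)
      free-answered []      {c ∷ a} {x}      {y} refl h 0<x (ans , _) =
        subst (λ u → G (u ++ y)) (drop-length-++ (c ∷ a))
          (ans (subst Hereditary (sym (take-length-++ (c ∷ a))) h)
               (subst (length (c ∷ a) <_) (sym (length-++ (c ∷ a))) (m<m+n _ 0<x)))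
      free-answered (c ∷ p) |a|≡n h 0<x (_ , f) = free-answered p |a|≡n h 0<x f

      free-short : ∀ p {y} → length p ≤ n → Free p y
      free-short []      _   = tt
      free-short (x ∷ p) p<n = (λ _ n<w → contradiction p<n (<⇒≱ n<w)) , free-short p (<⇒≤ p<n)

      -- This is why an event excludes events at the n preceding places. A block ending strictly
      -- inside p is answered by `Free p a`. One ending later, but strictly inside p ++ a, leaves a
      -- remainder that starts with a nonempty suffix of a, which is in G because a is hereditary.
      free-extend : ∀ p {a y} → length a ≡ n → Hereditary a → Free p a → Free (p ++ a) y
      free-extend []      {a} |a|≡n h f = free-short a (≤-reflexive |a|≡n)
      free-extend (x ∷ p) {a} {y} |a|≡n h (ans , f) = answered , free-extend p |a|≡n h f
        where
        w = x ∷ p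
        answered : Answered (w ++ a) y
        answered h′ n<wa with n <? length w
        ... | yes n<w = G-++ y (subst G (sym (drop-++ n w (<⇒≤ n<w)))
                          (ans (subst Hereditary (take-++ n w (<⇒≤ n<w)) h′) n<w))
        ... | no n≮w = G-++ y (hereditary⇒G
                (subst (0 <_) (sym (length-drop n (w ++ a))) (m<n⇒0<n∸m n<wa))
                (subst Hereditary (sym (drop-++ʳ n w (≮⇒≥ n≮w))) (hereditary-drop (n ∸ length w) h)))

      -- Every remainder is a nonempty suffix of a hereditary word.
      hereditary⇒free : ∀ p {y} → Hereditary (p ++ y) → Free p y
      hereditary⇒free []      h         = tt
      hereditary⇒free (x ∷ p) {y} h@(_ , h′) =
        (λ _ n<w → hereditary⇒G
          (<-≤-trans (subst (0 <_) (sym (length-drop n (x ∷ p))) (m<n⇒0<n∸m n<w)) (length-++-≤ˡ (drop n (x ∷ p))))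
          (subst Hereditary (drop-++ n (x ∷ p) (<⇒≤ n<w)) (hereditary-drop n h)))
        , hereditary⇒free p h′

      -- The recurrence for the number of free words

      #free : ℕ → ℕ
      -- This is `e M`, so d M is the probability up to the constant factor qⁿ. The first n letters
      -- decide membership in G, so n letters y of look-ahead stand for any continuation.
      #free M = Σʷ M (λ p → Σʷ n (λ y → ⟦ free? p y ⟧))

      private
        Σ¹-const : ∀ c → Σʷ 1 (λ _ → c) ≡ c * q
        Σ¹-const c = trans (Σʷ-const 1 c) (lemma q c)
          where
          lemma : ∀ q c → q * 1 * c ≡ c * q
          lemma = solve-∀

      -- A letter appended to y is harmless by `G-prefix`; `Σʷ-rotate` then splits off the first
      -- letter instead of the last.
      #avoiding-extend : #avoiding n * q ≤ Σʷ 1 (λ x → Σʷ n (λ y → ⟦ ¬? (G? (x ++ y)) ⟧))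
      #avoiding-extend = begin
        #avoiding n * q
          ≡⟨ Σʷ-*ʳ n _ q ⟨
        Σʷ n (λ y → ⟦ ¬? (G? y) ⟧ * q)
          ≡⟨ Σʷ-cong n (λ y → sym (Σ¹-const _)) ⟩
        Σʷ n (λ y → Σʷ 1 (λ x → ⟦ ¬? (G? y) ⟧))
          ≤⟨ Σʷ-mono n (λ y → Σʷ-mono 1 (λ x →
               ⟦⟧-mono (_∘ G-prefix _ (≤-reflexive (sym (length-toList y)))))) ⟩
        Σʷ n (λ y → Σʷ 1 (λ x → ⟦ ¬? (G? (y ++ x)) ⟧))
          ≡⟨ Σʷ-rotate n 1 (λ w → ⟦ ¬? (G? w) ⟧) ⟩
        Σʷ 1 (λ x → Σʷ n (λ y → ⟦ ¬? (G? (x ++ y)) ⟧)) ∎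

      free-extend-count : ∀ p → Σʷ 1 (λ x → Σʷ n (λ y → ⟦ free? p (x ++ y) ⟧)) ≤ Σʷ n (λ y → ⟦ free? p y ⟧) * q
      free-extend-count p = begin
        Σʷ 1 (λ x → Σʷ n (λ y → ⟦ free? p (x ++ y) ⟧))
          ≡⟨ Σʷ-rotate 1 n (λ w → ⟦ free? p w ⟧) ⟩
        Σʷ n (λ y → Σʷ 1 (λ x → ⟦ free? p (y ++ x) ⟧))
          ≤⟨ Σʷ-mono n (λ y → Σʷ-mono 1 (λ x →
               ⟦⟧-mono (free-prefix p (toList y) (≤-reflexive (sym (length-toList y)))))) ⟩
        Σʷ n (λ y → Σʷ 1 (λ x → ⟦ free? p y ⟧))
          ≡⟨ Σʷ-cong n (λ y → Σ¹-const _) ⟩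
        Σʷ n (λ y → ⟦ free? p y ⟧ * q)
          ≡⟨ Σʷ-*ʳ n _ q ⟩
        Σʷ n (λ y → ⟦ free? p y ⟧) * q ∎

      #freeHereditary : ℕ → ℕ
      #freeHereditary M = Σʷ M (λ p → Σʷ n (λ a → ⟦ free? p a ×-dec hereditary? a ⟧))

      #free-correlation : ∀ M → #free M * #hereditary n ≤ #freeHereditary M * q ^ n
      #free-correlation M = begin
        #free M * #hereditary n
          ≡⟨ Σʷ-*ʳ M _ _ ⟨
        Σʷ M (λ p → Σʷ n (λ y → ⟦ free? p y ⟧) * #hereditary n)
          ≤⟨ Σʷ-mono M (λ p → hereditary-correlation n ≤-refl (free? (toList p))
               (free-++ (toList p)) (free-late (toList p))) ⟩
        Σʷ M (λ p → Σʷ n (λ y → ⟦ free? p y ×-dec hereditary? y ⟧) * q ^ n)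
          ≡⟨ Σʷ-*ʳ M _ _ ⟩
        #freeHereditary M * q ^ n ∎

      private
        #new : List Ω → List Ω → ℕ
        #new p a = Σʷ 1 (λ x → Σʷ n (λ y → ⟦ free? ((p ++ a) ++ x) y ⟧))

      -- Continuations x ++ y of p ++ a are sorted by what happens at the end of a. The first term
      -- counts those that remain free once this place is tested, the second bounds from below those
      -- with an event there.
      free-step : ∀ p a → length a ≡ n →
        #new p a + ⟦ free? p a ×-dec hereditary? a ⟧ * (#avoiding n * q) ≤ Σʷ n (λ y → ⟦ free? (p ++ a) y ⟧) * q
      free-step p a |a|≡n = begin
        #new p a + i * (#avoiding n * q)
          ≤⟨ +-monoʳ-≤ (#new p a) (*-monoʳ-≤ i #avoiding-extend) ⟩
        #new p a + i * Σʷ 1 (λ x → Σʷ n (λ y → ⟦ ¬? (G? (x ++ y)) ⟧))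
          ≡⟨ cong (#new p a +_) (*-comm i _) ⟩
        #new p a + Σʷ 1 (λ x → Σʷ n (λ y → ⟦ ¬? (G? (x ++ y)) ⟧)) * i
          ≡⟨ cong (#new p a +_) (Σʷ-*ʳ 1 _ i) ⟨
        #new p a + Σʷ 1 (λ x → Σʷ n (λ y → ⟦ ¬? (G? (x ++ y)) ⟧) * i)
          ≡⟨ cong (#new p a +_) (Σʷ-cong 1 (λ x → sym (Σʷ-*ʳ n _ i))) ⟩
        #new p a + Σʷ 1 (λ x → Σʷ n (λ y → ⟦ ¬? (G? (x ++ y)) ⟧ * i))
          ≡⟨ Σʷ-+ 1 _ _ ⟨
        Σʷ 1 (λ x → Σʷ n (λ y → ⟦ free? ((p ++ a) ++ x) y ⟧) + Σʷ n (λ y → ⟦ ¬? (G? (x ++ y)) ⟧ * i))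
          ≡⟨ Σʷ-cong 1 (λ x → sym (Σʷ-+ n _ _)) ⟩
        Σʷ 1 (λ x → Σʷ n (λ y → ⟦ free? ((p ++ a) ++ x) y ⟧ + ⟦ ¬? (G? (x ++ y)) ⟧ * i))
          -- An event needs a hereditary and x ++ y outside G, which `free-answered` rules out for
          -- the first kind. Both kinds are free for p ++ a, the second by `free-extend`.
          ≤⟨ Σʷ-mono 1 (λ x → Σʷ-mono n (λ y →
               ⟦⟧-disjoint
                 (free-shift (p ++ a) (toList x))
                 (λ _ (f , h) → free-extend p |a|≡n h f)
                 (λ f ¬g (_ , h) → ¬g (free-answered p |a|≡n h (≤-reflexive (sym (length-toList x))) f)))) ⟩
        Σʷ 1 (λ x → Σʷ n (λ y → ⟦ free? (p ++ a) (x ++ y) ⟧))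
          ≤⟨ free-extend-count (p ++ a) ⟩
        Σʷ n (λ y → ⟦ free? (p ++ a) y ⟧) * q ∎
        where
        i = ⟦ free? p a ×-dec hereditary? a ⟧

      #free-split : ∀ M → #free (n + M) ≡ Σʷ M (λ p → Σʷ n (λ a → Σʷ n (λ y → ⟦ free? (p ++ a) y ⟧)))
      #free-split M = trans (cong #free (+-comm n M)) (Σʷ-split M n _)

      #free-split-suc : ∀ M → #free (suc (n + M)) ≡ Σʷ M (λ p → Σʷ n (λ a → #new p a))
      #free-split-suc M = begin-equality
        #free (suc (n + M))   ≡⟨ cong #free (lemma n M) ⟩
        #free ((M + n) + 1)   ≡⟨ Σʷ-split (M + n) 1 _ ⟩
        Σʷ (M + n) (λ p → Σʷ 1 (λ x → Σʷ n (λ y → ⟦ free? (p ++ x) y ⟧))) ≡⟨ Σʷ-split M n _ ⟩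
        Σʷ M (λ p → Σʷ n (λ a → #new p a)) ∎
        where
        lemma : ∀ n M → suc (n + M) ≡ (M + n) + 1
        lemma = solve-∀

      #free-step : ∀ M → #free (suc (n + M)) + #freeHereditary M * (#avoiding n * q) ≤ #free (n + M) * q
      #free-step M = begin
        #free (suc (n + M)) + #freeHereditary M * c
          ≡⟨ cong₂ _+_ (#free-split-suc M) (trans (sym (Σʷ-*ʳ M _ c)) (Σʷ-cong M (λ p → sym (Σʷ-*ʳ n _ c)))) ⟩
        Σʷ M (λ p → Σʷ n (λ a → #new p a)) + Σʷ M (λ p → Σʷ n (λ a → ⟦ free? p a ×-dec hereditary? a ⟧ * c))
          ≡⟨ Σʷ-+ M _ _ ⟨
        Σʷ M (λ p → Σʷ n (λ a → #new p a) + Σʷ n (λ a → ⟦ free? p a ×-dec hereditary? a ⟧ * c))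
          ≡⟨ Σʷ-cong M (λ p → sym (Σʷ-+ n _ _)) ⟩
        Σʷ M (λ p → Σʷ n (λ a → #new p a + ⟦ free? p a ×-dec hereditary? a ⟧ * c))
          ≤⟨ Σʷ-mono M (λ p → Σʷ-mono n (λ a → free-step (toList p) (toList a) (length-toList a))) ⟩
        Σʷ M (λ p → Σʷ n (λ a → Σʷ n (λ y → ⟦ free? (p ++ a) y ⟧) * q))
          ≡⟨ trans (Σʷ-cong M (λ p → Σʷ-*ʳ n _ q)) (Σʷ-*ʳ M _ q) ⟩
        Σʷ M (λ p → Σʷ n (λ a → Σʷ n (λ y → ⟦ free? (p ++ a) y ⟧))) * q
          ≡⟨ cong (_* q) (#free-split M) ⟨
        #free (n + M) * q ∎
        where
        c = #avoiding n * q

      -- `#free-step` multiplied by qⁿ, with `#free-correlation` bounding the number of hereditary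
      -- blocks from below.
      #free-recurrence : ∀ M →
        q ^ n * #free (suc (n + M)) + q * (#hereditary n * #avoiding n) * #free M ≤ q * q ^ n * #free (n + M)
      #free-recurrence M = begin
        q ^ n * #free (suc (n + M)) + q * (h * b) * #free M
          ≡⟨ lemma₁ (q ^ n) (#free (suc (n + M))) q h b (#free M) ⟩
        q ^ n * #free (suc (n + M)) + #free M * h * (b * q)
          ≤⟨ +-monoʳ-≤ _ (*-monoˡ-≤ (b * q) (#free-correlation M)) ⟩
        q ^ n * #free (suc (n + M)) + #freeHereditary M * q ^ n * (b * q)
          ≡⟨ lemma₂ (q ^ n) (#free (suc (n + M))) (#freeHereditary M) (b * q) ⟩
        q ^ n * (#free (suc (n + M)) + #freeHereditary M * (b * q))
          ≤⟨ *-monoʳ-≤ (q ^ n) (#free-step M) ⟩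
        q ^ n * (#free (n + M) * q)
          ≡⟨ lemma₃ (q ^ n) (#free (n + M)) q ⟩
        q * q ^ n * #free (n + M) ∎
        where
        h = #hereditary n
        b = #avoiding n
        lemma₁ : ∀ r e q h b f → r * e + q * (h * b) * f ≡ r * e + f * h * (b * q)
        lemma₁ = solve-∀
        lemma₂ : ∀ r e f c → r * e + f * r * c ≡ r * (e + f * c)
        lemma₂ = solve-∀
        lemma₃ : ∀ r e q → r * (e * q) ≡ q * r * e
        lemma₃ = solve-∀

      -- The last letter c is a nonempty suffix. The powers of c are then hereditary, hence free,
      -- which makes `#free` positive.
      last-letter : ∀ w → 0 < length w → Hereditary w → ∃ λ c → G [ c ]
      last-letter (c ∷ [])    _ (g , _) = c , g
      last-letter (_ ∷ d ∷ w) _ (_ , h) = last-letter (d ∷ w) (s≤s z≤n) h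

      hereditary-replicate : ∀ {c} → G [ c ] → ∀ m → Hereditary (toList (Vec.replicate m c))
      hereditary-replicate g zero    = tt
      hereditary-replicate g (suc m) = G-++ _ g , hereditary-replicate g m

      #free>0 : ∀ {c} → G [ c ] → ∀ M → 0 < #free M
      #free>0 {c} g M = begin
        1                                          ≤⟨ ⟦⟧-holds (hereditary⇒free (toList cᴹ)
                                                        (hereditary-++ (hereditary-replicate g M) (hereditary-replicate g n))) ⟩
        ⟦ free? (toList cᴹ) (toList cⁿ) ⟧          ≤⟨ term≤Σʷ _ cⁿ ⟩
        Σʷ n (λ y → ⟦ free? (toList cᴹ) y ⟧)       ≤⟨ term≤Σʷ (λ p → Σʷ n (λ y → ⟦ free? p y ⟧)) cᴹ ⟩
        #free M                                    ∎
        where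
        cᴹ = Vec.replicate M c
        cⁿ = Vec.replicate n c

      #hereditary*#avoiding-bound :
        #hereditary n * #avoiding n * suc n ^ suc n ≤ n ^ n * (q ^ n * q ^ n)
      #hereditary*#avoiding-bound with anyWord? {n = n} (hereditary? ∘ toList)
      ... | yes (w , h) with c , g ← last-letter (toList w) (subst (0 <_) (sym (length-toList w)) (ℕ.>-nonZero⁻¹ n)) h =
        positive-recurrence-bound n q (#hereditary n * #avoiding n) #free (#free>0 g) #free-recurrence
      -- Without hereditary words of length n the left side is 0.
      ... | no ¬h = ≤-trans (*-monoˡ-≤ (suc n ^ suc n) (*-monoˡ-≤ (#avoiding n) none)) z≤n
        where
        none : #hereditary n ≤ 0
        none = ≤-trans (Σʷ-mono n {g = λ _ → 0} (λ w → ⟦⟧-fails (λ h → ¬h (w , h))))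
                       (≤-reflexive (trans (Σʷ-const n 0) (*-zeroʳ (q ^ n))))

open import Defs
open import Data.Fin.Base using (Fin; zero; suc; toℕ)
import Data.Fin.Properties as Fin
open import Data.Integer.Base as ℤ using (+_)
import Data.Integer.Properties as ℤ
import Data.List.Relation.Binary.Pointwise as Pointwise
open import Data.List.Relation.Binary.Prefix.Heterogeneous using (Prefix; []; _∷_; _++ᵖ_)
open import Data.List.Relation.Binary.Prefix.Heterogeneous.Properties using (fromPointwise; prefix?)
open import Data.Rational.Base as ℚ using (ℚ; 0ℚ; 1ℚ; _<_; _≤_; _*_; _/_; _÷_; toℚᵘ; fromℚᵘ)
import Data.Rational.Properties as ℚ
open import Data.Rational.Unnormalised.Base as ℚᵘ using (mkℚᵘ)
import Data.Rational.Unnormalised.Properties as ℚᵘ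
open import Function.Properties.Inverse using (↔⇒↣)
open import Relation.Binary.Definitions using (DecidableEquality)

-- Overlaps of a suffix with a prefix

module _ {Ω : Set} where

  private
    Pre : List Ω → List Ω → Set
    Pre = Prefix _≡_

  Overlap : List Ω → List Ω → Set
  Overlap []      u = ⊥
  Overlap (x ∷ a) u = Pre (x ∷ a) u ⊎ Overlap a u

  overlap? : DecidableEquality Ω → ∀ a u → Dec (Overlap a u)
  overlap? _≟_ []      u = no id
  overlap? _≟_ (x ∷ a) u = prefix? _≟_ (x ∷ a) u ⊎-dec overlap? _≟_ a u

  overlap-++ : ∀ a {u} v → Overlap a u → Overlap a (u ++ v)
  overlap-++ (x ∷ a) v = Sum.map (_++ᵖ v) (overlap-++ a v)

  -- If a does not fit inside u, its letters beyond u form a nonempty suffix of a that is a prefix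
  -- of v.
  prefix-++⁻ : ∀ {a} u {v} → Pre a (u ++ v) → Pre a u ⊎ Overlap a v
  prefix-++⁻ {[]}    u       _            = inj₁ []
  prefix-++⁻ {x ∷ a} []      pre          = inj₂ (inj₁ pre)
  prefix-++⁻ {x ∷ a} (y ∷ u) (refl ∷ pre) = Sum.map (refl ∷_) inj₂ (prefix-++⁻ u pre)

  overlap-late : ∀ a u {v} → Overlap a (u ++ v) → ¬ Overlap a u → Overlap a v
  overlap-late (x ∷ a) u (inj₁ pre) ¬o = Sum.fromInj₂ (λ pre′ → contradiction (inj₁ pre′) ¬o) (prefix-++⁻ u pre)
  overlap-late (x ∷ a) u (inj₂ o)   ¬o = inj₂ (overlap-late a u o (¬o ∘ inj₂))

  prefix-short : ∀ {a u v} → length a ℕ.≤ length u → Pre a (u ++ v) → Pre a u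
  prefix-short {[]}    {_}     _         _         = []
  prefix-short {_ ∷ _} {_ ∷ _} (s≤s a≤u) (x ∷ pre) = x ∷ prefix-short a≤u pre

  overlap-short : ∀ a {u} v → length a ℕ.≤ length u → Overlap a (u ++ v) → Overlap a u
  overlap-short (x ∷ a) v a<u = Sum.map (prefix-short a<u) (overlap-short a v (ℕ.<⇒≤ a<u))

  overlap-shift : ∀ {m} (a : Vec Ω m) {u} → Overlap (toList a) u → ∃ λ (j : Fin m) → Pre (toList (shift^ (toℕ j) a)) u
  overlap-shift (x ∷ a) (inj₁ pre) = zero , pre
  overlap-shift (x ∷ a) (inj₂ o) with j , pre ← overlap-shift a o = suc j , pre

  prefix-complement : ∀ {a u} → Pre a u → ∃ λ z → a ++ z ≡ u
  prefix-complement {u = u} []           = u , refl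
  prefix-complement         (refl ∷ pre) = map₂ (cong (_ ∷_)) (prefix-complement pre)

  prefix⇒cylinder : ∀ {n} (j : Fin n) {B : Pred (Vec Ω (n ∸ toℕ j)) 0ℓ} {v u} →
    B v → Pre (toList v) (toList u) → cylinder j B u
  prefix⇒cylinder {n} j {B} {v} {u} b pre with z , v++z≡u ← prefix-complement pre =
    v , cast |z|≡j (fromList z) , b , toList-injective (ℕ.m∸n+n≡m j≤n) (v Vec.++ _) u (begin
      toList (v Vec.++ cast |z|≡j (fromList z))                          ≡⟨ toList-++ v _ ⟩
      toList v ++ toList (cast |z|≡j (fromList z))                       ≡⟨ cong (toList v ++_) (toList-cast |z|≡j (fromList z)) ⟩
      toList v ++ toList (fromList z)                                    ≡⟨ cong (toList v ++_) (toList∘fromList z) ⟩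
      toList v ++ z                                                      ≡⟨ v++z≡u ⟩
      toList u                                                           ∎)
    where
    open ≡-Reasoning
    j≤n : toℕ j ℕ.≤ n
    j≤n = ℕ.<⇒≤ (Fin.toℕ<n j)
    |z|≡j : length z ≡ toℕ j
    |z|≡j = ℕ.+-cancelˡ-≡ (n ∸ toℕ j) _ _ (begin
      n ∸ toℕ j ℕ.+ length z          ≡⟨ cong (ℕ._+ length z) (length-toList v) ⟨
      length (toList v) ℕ.+ length z  ≡⟨ length-++ (toList v) ⟨
      length (toList v ++ z)          ≡⟨ cong length v++z≡u ⟩
      length (toList u)               ≡⟨ length-toList u ⟩
      n                               ≡⟨ ℕ.m∸n+n≡m j≤n ⟨
      n ∸ toℕ j ℕ.+ toℕ j             ∎)

-- Application to A and U(A)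

module _ {Ω : Set} {{fin : FiniteNonempty Ω}} {n : ℕ} .{{_ : NonZero n}} {A : Pred (Vec Ω n) 0ℓ} (A? : Decidable A) where
  open FiniteNonempty fin using (size; enumeration)

  -- The set G, on words of every length, since remainders of any length are tested.
  StartsInSuffix : Pred (List Ω) 0ℓ
  StartsInSuffix u = ∃ λ a → A a × Overlap (toList a) u

  startsInSuffix? : Decidable StartsInSuffix
  startsInSuffix? u = anyWord? (λ a → A? a ×-dec overlap? (Fin.inj⇒≟ (↔⇒↣ enumeration)) (toList a) u)

  open Occurrences n startsInSuffix?
    (λ v (a , Aa , o) → a , Aa , overlap-++ (toList a) v o)
    (λ u (a , Aa , o) ¬s → a , Aa , overlap-late (toList a) u o (λ o′ → ¬s (a , Aa , o′)))
    (λ v n≤u (a , Aa , o) →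
      a , Aa , overlap-short (toList a) v (ℕ.≤-trans (ℕ.≤-reflexive (length-toList a)) n≤u) o)

  -- The hypothesis on w expresses that w is a suffix of a, in a form that passes to the tail of w.
  -- Each nonempty suffix is in G as a prefix of itself.
  hereditary-suffixes : ∀ {a} → A a → ∀ w → (∀ {u} → Overlap w u → Overlap (toList a) u) → Hereditary w
  hereditary-suffixes Aa []      _   = _
  hereditary-suffixes Aa (x ∷ w) w⊂a =
    (_ , Aa , w⊂a (inj₁ (fromPointwise (Pointwise.refl refl)))) , hereditary-suffixes Aa w (w⊂a ∘ inj₂)

  U-avoids : ∀ u → U A u → ¬ StartsInSuffix (toList u)
  U-avoids u u∈U (a , Aa , o) with j , pre ← overlap-shift a o =
    u∈U (j , prefix⇒cylinder j (a , Aa , refl) pre)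

  -- Words of A are hereditary and words of U(A) avoid G.
  card-bound : card A? ℕ.* card (U? A?) ℕ.* suc n ℕ.^ suc n ℕ.≤ n ℕ.^ n ℕ.* (size ℕ.^ n ℕ.* size ℕ.^ n)
  card-bound = ℕ.≤-trans
    (ℕ.*-monoˡ-≤ (suc n ℕ.^ suc n) (ℕ.*-mono-≤
      (card≤Σʷ A? (λ a Aa → hereditary-suffixes Aa (toList a) id))
      (card≤Σʷ (U? A?) U-avoids)))
    #hereditary*#avoiding-bound

-- From counts to rational densities

fromℚᵘ-homo-* : ∀ p q → fromℚᵘ (p ℚᵘ.* q) ≡ fromℚᵘ p * fromℚᵘ q
fromℚᵘ-homo-* p q = ℚ.toℚᵘ-injective (begin
  toℚᵘ (fromℚᵘ (p ℚᵘ.* q))                 ≈⟨ ℚ.toℚᵘ-fromℚᵘ (p ℚᵘ.* q) ⟩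
  p ℚᵘ.* q                                 ≈⟨ ℚᵘ.*-cong (ℚ.toℚᵘ-fromℚᵘ p) (ℚ.toℚᵘ-fromℚᵘ q) ⟨
  toℚᵘ (fromℚᵘ p) ℚᵘ.* toℚᵘ (fromℚᵘ q)     ≈⟨ ℚ.toℚᵘ-homo-* (fromℚᵘ p) (fromℚᵘ q) ⟨
  toℚᵘ (fromℚᵘ p * fromℚᵘ q)               ∎)
  where open ℚᵘ.≃-Reasoning

module _ (a b c d : ℕ) .{{_ : NonZero b}} .{{_ : NonZero d}} where

  /-*-/ : ∀ .{{_ : NonZero (b ℕ.* d)}} → (+ a / b) * (+ c / d) ≡ + (a ℕ.* c) / (b ℕ.* d)
  -- The local lemma quantifies over b and d again so that they can be matched as successors, where
  -- `_/_` is `fromℚᵘ` of a fraction.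
  /-*-/ = lemma b d
    where
    lemma : ∀ b d .{{_ : NonZero b}} .{{_ : NonZero d}} .{{_ : NonZero (b ℕ.* d)}} →
      (+ a / b) * (+ c / d) ≡ + (a ℕ.* c) / (b ℕ.* d)
    lemma (suc b) (suc d) = trans (sym (fromℚᵘ-homo-* (mkℚᵘ (+ a) b) (mkℚᵘ (+ c) d)))
      (cong (_/ (suc b ℕ.* suc d)) (sym (ℤ.pos-* a c)))

  /-mono-≤ : a ℕ.* d ℕ.≤ c ℕ.* b → + a / b ≤ + c / d
  /-mono-≤ = lemma b d
    where
    open ℚᵘ.≤-Reasoning
    lemma : ∀ b d .{{_ : NonZero b}} .{{_ : NonZero d}} → a ℕ.* d ℕ.≤ c ℕ.* b → + a / b ≤ + c / d
    lemma (suc b) (suc d) ad≤cb = ℚ.toℚᵘ-cancel-≤ (begin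
      toℚᵘ (fromℚᵘ (mkℚᵘ (+ a) b)) ≃⟨ ℚ.toℚᵘ-fromℚᵘ (mkℚᵘ (+ a) b) ⟩
      mkℚᵘ (+ a) b                 ≤⟨ ℚᵘ.*≤* (subst₂ ℤ._≤_ (ℤ.pos-* a (suc d)) (ℤ.pos-* c (suc b)) (ℤ.+≤+ ad≤cb)) ⟩
      mkℚᵘ (+ c) d                 ≃⟨ ℚ.toℚᵘ-fromℚᵘ (mkℚᵘ (+ c) d) ⟨
      toℚᵘ (fromℚᵘ (mkℚᵘ (+ c) d)) ∎)

/-^ : ∀ a b .{{_ : NonZero b}} k → (+ a / b) ^ k ≡ (+ (a ℕ.^ k) / (b ℕ.^ k)) {{ℕ.m^n≢0 b k}}
/-^ a b zero    = refl
/-^ a b {{b≢0}} (suc k) = trans (cong ((+ a / b) *_) (/-^ a b k))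
  (/-*-/ a b (a ℕ.^ k) (b ℕ.^ k) {{b≢0}} {{ℕ.m^n≢0 b k}} {{ℕ.m^n≢0 b (suc k)}})

≤-÷ : ∀ {p q} r .{{_ : ℚ.Positive r}} .{{_ : ℚ.NonZero r}} → p * r ≤ q → p ≤ q * (1ℚ ÷ r)
≤-÷ {p} {q} r pr≤q = ℚ.*-cancelʳ-≤-pos r (begin
  p * r                ≤⟨ pr≤q ⟩
  q                    ≡⟨ ℚ.*-identityʳ q ⟨
  q * 1ℚ               ≡⟨ cong (q *_) (ℚ.*-inverseˡ r) ⟨
  q * (ℚ.1/ r * r)     ≡⟨ cong (λ x → q * (x * r)) (ℚ.*-identityˡ (ℚ.1/ r)) ⟨
  q * ((1ℚ ÷ r) * r)   ≡⟨ ℚ.*-assoc q (1ℚ ÷ r) r ⟨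
  q * (1ℚ ÷ r) * r     ∎)
  where open ℚ.≤-Reasoning

module _ (n a u Q : ℕ) .{{_ : NonZero n}} .{{Q≢0 : NonZero Q}} where

  private
    L = suc n ℕ.^ suc n

    instance
      Q1≢0 : NonZero (Q ℕ.* 1)
      Q1≢0 = ℕ.m*n≢0 Q 1
      QQ1≢0 : NonZero (Q ℕ.* (Q ℕ.* 1))
      QQ1≢0 = ℕ.m*n≢0 Q (Q ℕ.* 1)
      L≢0 : NonZero L
      L≢0 = ℕ.m^n≢0 (suc n) (suc n)

  density-bound : a ℕ.* u ℕ.* L ℕ.≤ n ℕ.^ n ℕ.* (Q ℕ.* Q) →
    ∀ {α β} → + a / Q ≡ α → + u / Q ≡ β → β * (α * (+ n / 1)) ≤ (+ n / suc n) ^ suc n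
  density-bound bound refl refl = begin
    (+ u / Q) * ((+ a / Q) * (+ n / 1))         ≡⟨ cong ((+ u / Q) *_) (/-*-/ a Q n 1) ⟩
    (+ u / Q) * (+ (a ℕ.* n) / (Q ℕ.* 1))       ≡⟨ /-*-/ u Q (a ℕ.* n) (Q ℕ.* 1) ⟩
    + (u ℕ.* (a ℕ.* n)) / (Q ℕ.* (Q ℕ.* 1))     ≤⟨ /-mono-≤ (u ℕ.* (a ℕ.* n)) _ (n ℕ.^ suc n) L cross ⟩
    + (n ℕ.^ suc n) / L                         ≡⟨ /-^ n (suc n) (suc n) ⟨
    (+ n / suc n) ^ suc n                       ∎
    where
    open ℚ.≤-Reasoning
    lemma₁ : ∀ n a u L → n ℕ.* (a ℕ.* u ℕ.* L) ≡ u ℕ.* (a ℕ.* n) ℕ.* L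
    lemma₁ = solve-∀
    lemma₂ : ∀ n k Q → n ℕ.* (k ℕ.* (Q ℕ.* Q)) ≡ n ℕ.* k ℕ.* (Q ℕ.* (Q ℕ.* 1))
    lemma₂ = solve-∀
    cross : u ℕ.* (a ℕ.* n) ℕ.* L ℕ.≤ n ℕ.^ suc n ℕ.* (Q ℕ.* (Q ℕ.* 1))
    -- The factor n of αn turns nⁿ into nⁿ⁺¹.
    cross = subst₂ ℕ._≤_ (lemma₁ n a u L) (lemma₂ n (n ℕ.^ n) Q) (ℕ.*-monoʳ-≤ n bound)

theorem1p1 : ∀ (n : ℕ) .{{_ : NonZero n}} (α : ℚ) (0<α : 0ℚ < α) → α < 1ℚ →
    ∀ (Ω : Set) {{_ : FiniteNonempty Ω}} (A : Pred (Vec Ω n) 0ℓ) (A? : Decidable A) →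
    μ A? ≡ α →
    μ (U? A?) ≤ ((+ n / suc n) ^ suc n) * (_÷_ 1ℚ (α * (+ n / 1)) {{α*n≢0 0<α n}})
theorem1p1 n α 0<α α<1 Ω {{fin}} A A? μA≡α =
  ≤-÷ (α * (+ n / 1)) {{ℚ.pos*pos⇒pos α {{ℚ.positive 0<α}} (+ n / 1) {{ℚ.normalize-pos n 1}}}} {{α*n≢0 0<α n}}
    (density-bound n (card A?) (card (U? A?)) (size ℕ.^ n) {{Q≢0 = ℕ.m^n≢0 size n}} (card-bound A?) μA≡α refl)
  where open FiniteNonempty fin using (size; size≢0)
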